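{- Let $n\geq 2$ be an integer and let $S$ be a sequence in $\mathbb Z_n$. The following are equivalent: (a) $S$ is a $D$-extremal sequence for $(\{1\},\{1\})$; (b) $S$ is an $E$-extremal sequence for $(\{1\},\{1\})$; (c) $S$ is an $E$-extremal sequence for $\{1\}$; (d) $S$ is a translate of a sequence which is equivalent to the sequence $(0,\ldots,0,1,\ldots,1)$ consisting of $n-1$ zeroes followed by $n-1$ ones.
   Context: $\mathbb Z_n=\mathbb Z/n\mathbb Z$ as a module over itself. A subsequence is a non-empty subfamily of terms in the original order. For non-empty $A,B\subseteq\mathbb Z_n$, a sequence $(x_1,\ldots,x_k)$ is an $(A,B)$-weighted zero-sum sequence if there exist $a_i\in A$, $b_i\in B$ with $\sum a_ix_i=0$ and $\sum b_ia_i=0$; it is an $A$-weighted zero-sum sequence if there exist $a_i\in A$ with $\sum a_ix_i=0$. $D_{A,B}(n)$ (resp. $E_{A,B}(n)$) is the least positive $k$ such that every sequence of length $k$ in $\mathbb Z_n$ has an $(A,B)$-weighted zero-sum subsequence (resp. of length $n$); $E_A(n)$ is the least positive $k$ such that every sequence of length $k$ has an $A$-weighted zero-sum subsequence of length $n$. A $D$-extremal sequence for $(A,B)$ is a sequence of length $D_{A,B}(n)-1$ with no $(A,B)$-weighted zero-sum subsequence; an $E$-extremal sequence for $(A,B)$ is a sequence of length $E_{A,B}(n)-1$ with no $(A,B)$-weighted zero-sum subsequence of length $n$; an $E$-extremal sequence for $A$ is a sequence of length $E_A(n)-1$ with no $A$-weighted zero-sum subsequence of length $n$. A translate of $(x_1,\ldots,x_k)$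 is $(x_1+x,\ldots,x_k+x)$ for some $x\in\mathbb Z_n$. Sequences $(x_1,\ldots,x_k)$ and $(y_1,\ldots,y_k)$ are equivalent if there exist a permutation $\sigma$ of $[1,k]$ and a unit $u\in\mathbb Z_n$ with $y_{\sigma(i)}=ux_i$ for all $i$. -}

module Defs where

open import Data.Nat using (ℕ; zero; suc; _+_; _*_; _∸_; _≤_; _<_; NonZero)
open import Data.Nat.DivMod using (_mod_)
open import Data.Fin using (Fin; toℕ) renaming (zero to fzero; suc to fsuc)
open import Data.List using (List; []; _∷_; length; lookup; map; replicate; _++_)
open import Data.List.Relation.Binary.Sublist.Propositional using (_⊆_)
open import Data.List.Relation.Binary.Permutation.Propositional using (_↭_)
open import Data.Product using (Σ; ∃; ∃-syntax; _×_; _,_)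
open import Relation.Binary.PropositionalEquality using (_≡_; _≢_)
open import Relation.Nullary using (¬_)
open import Function using (_∘_)

Zn : ℕ → Set
Zn n = Fin n

module _ {n : ℕ} .{{_ : NonZero n}} where

  0ₙ : Zn n
  0ₙ = 0 mod n

  1ₙ : Zn n
  1ₙ = 1 mod n

  _+ₙ_ : Zn n → Zn n → Zn n
  a +ₙ b = (toℕ a + toℕ b) mod n

  _*ₙ_ : Zn n → Zn n → Zn n
  a *ₙ b = (toℕ a * toℕ b) mod n

  sumₙ : (k : ℕ) → (Fin k → Zn n) → Zn n
  sumₙ zero f = 0ₙ
  sumₙ (suc k) f = f fzero +ₙ sumₙ k (f ∘ fsuc)

  IsUnit : Zn n → Set
  IsUnit u = ∃[ v ] (u *ₙ v ≡ 1ₙ)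

  Subset : Set₁
  Subset = Zn n → Set

  ｛1｝ : Subset
  ｛1｝ x = x ≡ 1ₙ

  ABZeroSum : Subset → Subset → List (Zn n) → Set
  ABZeroSum A B T =
    Σ (Fin (length T) → Zn n) λ a →
    Σ (Fin (length T) → Zn n) λ b →
      (∀ i → A (a i)) × (∀ i → B (b i)) ×
      (sumₙ (length T) (λ i → a i *ₙ lookup T i) ≡ 0ₙ) ×
      (sumₙ (length T) (λ i → b i *ₙ a i) ≡ 0ₙ)

  AZeroSum : Subset → List (Zn n) → Set
  AZeroSum A T =
    Σ (Fin (length T) → Zn n) λ a →
      (∀ i → A (a i)) ×
      (sumₙ (length T) (λ i → a i *ₙ lookup T i) ≡ 0ₙ)

  IsSubseq : List (Zn n) → List (Zn n) → Set
  IsSubseq T S = (T ⊆ S) × (T ≢ [])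

  HasABZS : Subset → Subset → List (Zn n) → Set
  HasABZS A B S = ∃[ T ] (IsSubseq T S × ABZeroSum A B T)

  HasABZSn : Subset → Subset → List (Zn n) → Set
  HasABZSn A B S = ∃[ T ] (IsSubseq T S × length T ≡ n × ABZeroSum A B T)

  HasAZSn : Subset → List (Zn n) → Set
  HasAZSn A S = ∃[ T ] (IsSubseq T S × length T ≡ n × AZeroSum A T)

  IsLeastPos : (ℕ → Set) → ℕ → Set
  IsLeastPos P k = (0 < k) × P k × (∀ m → 0 < m → P m → k ≤ m)

  Every : (List (Zn n) → Set) → ℕ → Set
  Every Q k = ∀ (S : List (Zn n)) → length S ≡ k → Q S

  DExtremalAB : Subset → Subset → List (Zn n) → Set
  DExtremalAB A B S =
    ∃[ D ] (IsLeastPos (Every (HasABZS A B)) D × suc (length S) ≡ D × ¬ HasABZS A B S)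

  EExtremalAB : Subset → Subset → List (Zn n) → Set
  EExtremalAB A B S =
    ∃[ E ] (IsLeastPos (Every (HasABZSn A B)) E × suc (length S) ≡ E × ¬ HasABZSn A B S)

  EExtremalA : Subset → List (Zn n) → Set
  EExtremalA A S =
    ∃[ E ] (IsLeastPos (Every (HasAZSn A)) E × suc (length S) ≡ E × ¬ HasAZSn A S)

  IsTranslateOf : List (Zn n) → List (Zn n) → Set
  IsTranslateOf S T = ∃[ x ] (S ≡ map (λ t → t +ₙ x) T)

  Equivalent : List (Zn n) → List (Zn n) → Set
  Equivalent X Y = ∃[ u ] (IsUnit u × (Y ↭ map (λ x → u *ₙ x) X))

  zerosOnes : List (Zn n)
  zerosOnes = replicate (n ∸ 1) 0ₙ ++ replicate (n ∸ 1) 1ₙ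

{-# OPTIONS --safe #-}
-- Say that 0 has the largest multiplicity h in a sequence S over ℤₙ, and let R be the rest of S.
-- Since no element occurs more than h times in R, R splits into h sets. By Scherk's theorem
-- (|A + B| ≥ |A| + |B| − 1 if 0 ∈ A ∩ B and 0 = a + b only for a = b = 0), h sets of total size ≥ n
-- have a non-empty zero-sum choice of at most one element from each. So as long as |R| ≥ n, a
-- zero-sum of length ≤ h can be removed from R; the removed terms padded with zeros give the
-- Erdős–Ginzburg–Ziv theorem, so that all three constants equal 2n − 1.
--
-- If |S| = 2n − 2 and S has no n-term zero-sum, the removed part W has length exactly n − 1 − h, and
-- the n − 1 remaining terms have no zero-sum of length ≤ h + 1. If one of the sets they split into had
-- two elements, adjoining to it the sum of its maximum and minimum (as integers in [0, n)), which is a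
-- new element, would gain one in size at the cost of one more term, and Scherk's theorem would give
-- such a zero-sum. Hence h = n − 1 and the remaining terms are all equal to some g, which is a unit
-- because kg ≠ 0 for 0 < k < n.
module Submission where

open import Defs
open import Algebra.Bundles using (AbelianGroup; CommutativeMonoid)
import Algebra.Properties.AbelianGroup as AbelianGroupProperties
import Algebra.Properties.CommutativeSemigroup as CommutativeSemigroupProperties
open import Data.Fin using (Fin; toℕ) renaming (zero to fzero; suc to fsuc)
open import Data.Fin.Properties using (toℕ-injective; toℕ-fromℕ<; toℕ<n; _≟_; injective⇒≤)
open import Data.List using (List; []; _∷_; length; map; replicate; _++_; concat; filter; foldr; lookup; [_]; allFin; take)
import Data.List.Membership.DecPropositional as DecMembership
open import Data.List.Membership.Propositional using (_∈_; _∉_; find; lose)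
open import Data.List.Membership.Propositional.Properties
  using (∈-filter⁺; ∈-filter⁻; ∈-length; ∈-++⁺ˡ; ∈-++⁻; ∈-map⁻; ∈-lookup; ∈-allFin)
open import Data.List.Properties
  using (length-++; length-map; length-replicate; length-take; length-filter; filter-++; filter-accept;
         filter-none; filter-all; ++-assoc; ++-identityʳ; map-∘; map-cong; map-id; map-++; map-replicate;
         concat-map-[_])
open import Data.List.Relation.Binary.Permutation.Propositional as Perm
  using (_↭_; prep; swap; ↭-refl; ↭-sym; ↭-trans; ↭-reflexive)
open import Data.List.Relation.Binary.Permutation.Propositional.Properties
  using (++⁺; ++⁺ˡ; map⁺; shift; shifts; ++-comm; filter-↭; ↭-length; ++-commutativeMonoid)
open import Data.List.Relation.Binary.Sublist.Propositional using (_⊆_; []; _∷_; _∷ʳ_; ⊆-refl; ⊆-trans; from∈)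
import Data.List.Relation.Binary.Sublist.Propositional.Properties as Sub
open import Data.List.Relation.Unary.All as All using (All; []; _∷_)
open import Data.List.Relation.Unary.All.Properties
  using (¬Any⇒All¬; ¬All⇒Any¬; replicate⁺) renaming (map⁺ to All-map⁺)
open import Data.List.Relation.Unary.AllPairs using ([]; _∷_)
open import Data.List.Relation.Unary.Any using (here; there; any?)
open import Data.List.Relation.Unary.Unique.Propositional using (Unique)
import Data.List.Relation.Unary.Unique.Propositional.Properties as Unique
open import Data.Nat
  using (ℕ; zero; suc; _+_; _*_; _∸_; _≤_; _<_; z≤n; s≤s; _≤?_; _<?_; NonZero; _%_; ≢-nonZero⁻¹)
open import Data.Nat.Coprimality using (gcd≡1⇒coprime; coprime-Bézout)
open import Data.Nat.DivMod
open import Data.Nat.Divisibility using (divides; _∣_; m%n≡0⇒n∣m)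
open import Data.Nat.GCD using (gcd; gcd[m,n]∣m; gcd[m,n]∣n; module Bézout)
open import Data.Nat.Induction using (<-wellFounded)
open import Data.Nat.ListAction using (sum)
open import Data.Nat.ListAction.Properties using (sum-++)
open import Data.Nat.Properties hiding (_≟_)
open import Data.List.Extrema ≤-totalOrder
  using (argmax; argmin; argmax-sel; argmin-sel; f[argmin]≤f[xs]; f[xs]≤f[argmax])
open import Data.Nat.Tactic.RingSolver using (solve-∀)
open import Data.Product using (∃₂; ∃-syntax; Σ-syntax; _×_; _,_; proj₁; proj₂)
open import Data.Sum using (_⊎_; inj₁; inj₂; [_,_]′)
open import Function using (_∘_)
open import Function.Bundles using (_⇔_; mk⇔; Equivalence)
open import Function.Construct.Composition using (_⇔-∘_)
open import Function.Construct.Symmetry using (⇔-sym)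
open import Induction.WellFounded using (Acc; acc)
open import Level using (0ℓ)
open import Relation.Binary.Definitions using (DecidableEquality)
open import Relation.Binary.PropositionalEquality
  using (_≡_; _≢_; refl; sym; trans; cong; cong₂; subst; isEquivalence; module ≡-Reasoning)
open import Relation.Nullary using (Dec; ¬_; yes; no; contradiction)
open import Relation.Nullary.Decidable using (¬?)
open import Relation.Unary using (Pred; Decidable)

module _ {A : Set} where

  infix 4 _≼_

  _≼_ : List A → List A → Set
  xs ≼ ys = ∃[ zs ] (ys ↭ xs ++ zs)

  ⊆⇒≼ : ∀ {xs ys} → xs ⊆ ys → xs ≼ ys
  ⊆⇒≼ [] = [] , ↭-refl
  ⊆⇒≼ {xs} (y ∷ʳ p) with zs , q ← ⊆⇒≼ p = y ∷ zs , ↭-trans (prep y q) (↭-sym (shift y xs zs))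
  ⊆⇒≼ {x ∷ _} (refl ∷ p) with zs , q ← ⊆⇒≼ p = zs , prep x q

  ⊆-resp-↭ : ∀ {xs ys zs : List A} → xs ⊆ ys → ys ↭ zs → ∃[ xs′ ] (xs′ ⊆ zs × xs′ ↭ xs)
  ⊆-resp-↭ p Perm.refl = _ , p , ↭-refl
  ⊆-resp-↭ (_ ∷ʳ p) (prep x q) with _ , r , s ← ⊆-resp-↭ p q = _ , x ∷ʳ r , s
  ⊆-resp-↭ (refl ∷ p) (prep x q) with _ , r , s ← ⊆-resp-↭ p q = _ , refl ∷ r , prep x s
  ⊆-resp-↭ (_ ∷ʳ (_ ∷ʳ p)) (swap x y q) with _ , r , s ← ⊆-resp-↭ p q = _ , y ∷ʳ (x ∷ʳ r) , s
  ⊆-resp-↭ (_ ∷ʳ (refl ∷ p)) (swap x y q) with _ , r , s ← ⊆-resp-↭ p q = _ , refl ∷ (x ∷ʳ r) , prep y s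
  ⊆-resp-↭ (refl ∷ (_ ∷ʳ p)) (swap x y q) with _ , r , s ← ⊆-resp-↭ p q = _ , y ∷ʳ (refl ∷ r) , prep x s
  ⊆-resp-↭ (refl ∷ (refl ∷ p)) (swap x y q) with _ , r , s ← ⊆-resp-↭ p q = _ , refl ∷ (refl ∷ r) , swap y x s
  ⊆-resp-↭ p (Perm.trans q q′) with _ , r , s ← ⊆-resp-↭ p q with _ , r′ , s′ ← ⊆-resp-↭ r q′ = _ , r′ , ↭-trans s′ s

  ≼⇒⊆ : ∀ {xs ys} → xs ≼ ys → ∃[ xs′ ] (xs′ ⊆ ys × xs′ ↭ xs)
  ≼⇒⊆ (zs , q) = ⊆-resp-↭ (Sub.++⁺ʳ zs ⊆-refl) (↭-sym q)

  ≼-resp-↭ : ∀ {xs ys zs} → xs ≼ ys → ys ↭ zs → xs ≼ zs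
  ≼-resp-↭ (ws , q) p = ws , ↭-trans (↭-sym p) q

  ++-mono-≼ : ∀ {us vs xs ys} → us ≼ xs → vs ≼ ys → us ++ vs ≼ xs ++ ys
  ++-mono-≼ {us} {vs} (ws , p) (zs , q) =
    ws ++ zs , ↭-trans (++⁺ p q) (interchange us ws vs zs)
    where open CommutativeSemigroupProperties
                 (CommutativeMonoid.commutativeSemigroup (++-commutativeMonoid {A = A}))

  replicate-mono-≼ : ∀ {k m} (x : A) → k ≤ m → replicate k x ≼ replicate m x
  replicate-mono-≼ x z≤n = replicate _ x , ↭-refl
  replicate-mono-≼ x (s≤s k≤m) with zs , q ← replicate-mono-≼ x k≤m = zs , prep x q

  replicate-unfold : ∀ {x : A} {xs} → All (x ≡_) xs → xs ≡ replicate (length xs) x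
  replicate-unfold [] = refl
  replicate-unfold (refl ∷ ps) = cong (_ ∷_) (replicate-unfold ps)

  filter-split : ∀ {P : Pred A 0ℓ} (P? : Decidable P) xs → xs ↭ filter P? xs ++ filter (λ x → ¬? (P? x)) xs
  filter-split P? [] = ↭-refl
  filter-split P? (x ∷ xs) with P? x
  ... | yes _ = prep x (filter-split P? xs)
  ... | no _ = ↭-trans (prep x (filter-split P? xs)) (↭-sym (shift x (filter P? xs) _))

  large-block : ∀ {P : List A → Set} Bs → All P Bs → length Bs < length (concat Bs) →
    ∃₂ λ B Bs′ → P B × 2 ≤ length B × All P Bs′ × length Bs ≡ suc (length Bs′) ×
      B ++ concat Bs′ ↭ concat Bs
  large-block (B ∷ Bs) (p ∷ ps) lt with 2 ≤? length B
  ... | yes 2≤B = B , Bs , p , 2≤B , ps , refl , ↭-refl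
  ... | no 2≰B with B′ , Bs′ , p′ , 2≤B′ , ps′ , eq , q ← large-block Bs ps
                      (≤-pred (<-≤-trans lt (≤-trans (≤-reflexive (length-++ B))
                        (+-monoˡ-≤ (length (concat Bs)) (≤-pred (≰⇒> 2≰B)))))) =
    B′ , B ∷ Bs′ , p′ , 2≤B′ , p ∷ ps′ , cong suc eq , ↭-trans (shifts B′ B) (++⁺ˡ B q)

module Multiplicity {A : Set} (_≟_ : DecidableEquality A) where

  open DecMembership _≟_ using (_∈?_)

  count : A → List A → ℕ
  count x xs = length (filter (x ≟_) xs)

  count-++ : ∀ x xs ys → count x (xs ++ ys) ≡ count x xs + count x ys
  count-++ x xs ys = trans (cong length (filter-++ (x ≟_) xs ys)) (length-++ (filter (x ≟_) xs))

  count-↭ : ∀ x {xs ys} → xs ↭ ys → count x xs ≡ count x ys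
  count-↭ x p = ↭-length (filter-↭ (x ≟_) p)

  count-mono : ∀ x {xs ys} → xs ≼ ys → count x xs ≤ count x ys
  count-mono x {xs} (zs , p) = ≤-trans (m≤m+n _ _)
    (≤-reflexive (trans (sym (count-++ x xs zs)) (sym (count-↭ x p))))

  count-map : ∀ {f : A → A} → (∀ {x y} → f x ≡ f y → x ≡ y) → ∀ x xs → count (f x) (map f xs) ≡ count x xs
  count-map f-inj x [] = refl
  count-map {f} f-inj x (y ∷ ys) with f x ≟ f y | x ≟ y
  ... | yes _  | yes _ = cong suc (count-map f-inj x ys)
  ... | no _   | no _ = count-map f-inj x ys
  ... | yes eq | no x≢y = contradiction (f-inj eq) x≢y
  ... | no neq | yes x≡y = contradiction (cong f x≡y) neq

  count-concat : ∀ x {Bs} → All (x ∈_) Bs → length Bs ≤ count x (concat Bs)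
  count-concat x [] = z≤n
  count-concat x {B ∷ Bs} (p ∷ ps) = ≤-trans
    (+-mono-≤ (∈-length (∈-filter⁺ (x ≟_) p refl)) (count-concat x ps))
    (≤-reflexive (sym (count-++ x B (concat Bs))))

  insert : ∀ x Bs → All Unique Bs →
    (∃[ Bs′ ] (length Bs′ ≡ length Bs × All Unique Bs′ × concat Bs′ ↭ x ∷ concat Bs)) ⊎ All (x ∈_) Bs
  insert x [] [] = inj₂ []
  insert x (B ∷ Bs) (u ∷ us) with x ∈? B
  ... | no x∉B = inj₁ ((x ∷ B) ∷ Bs , refl , (¬Any⇒All¬ B x∉B ∷ u) ∷ us , ↭-refl)
  ... | yes x∈B with insert x Bs us
  ...   | inj₂ x∈Bs = inj₂ (x∈B ∷ x∈Bs)
  ...   | inj₁ (Bs′ , eq , us′ , p) =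
    inj₁ (B ∷ Bs′ , cong suc eq , u ∷ us′ , ↭-trans (++⁺ˡ B p) (shift x B (concat Bs)))

  empty-blocks : ∀ h → Σ[ Bs ∈ List (List A) ] (length Bs ≡ h × All Unique Bs × concat Bs ≡ [])
  empty-blocks zero = [] , refl , [] , refl
  empty-blocks (suc h) with Bs , eq , us , p ← empty-blocks h = [] ∷ Bs , cong suc eq , [] ∷ us , p

  set-partition : ∀ h xs → (∀ x → count x xs ≤ h) →
    ∃[ Bs ] (length Bs ≡ h × All Unique Bs × concat Bs ↭ xs)
  set-partition h [] _ with Bs , eq , us , p ← empty-blocks h = Bs , eq , us , ↭-reflexive p
  set-partition h (x ∷ xs) bd
    with Bs , eq , us , p ← set-partition h xs
           (λ y → ≤-trans (count-mono y (⊆⇒≼ (x ∷ʳ ⊆-refl))) (bd y))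
    with insert x Bs us
  ... | inj₁ (Bs′ , eq′ , us′ , p′) = Bs′ , trans eq′ eq , us′ , ↭-trans p′ (prep x p)
  ... | inj₂ x∈Bs = contradiction (bd x) (<⇒≱ (begin-strict
      h                     ≡⟨ eq ⟨
      length Bs             ≤⟨ count-concat x x∈Bs ⟩
      count x (concat Bs)   ≡⟨ count-↭ x p ⟩
      count x xs            <⟨ n<1+n _ ⟩
      suc (count x xs)      ≡⟨ cong length (filter-accept (x ≟_) refl) ⟨
      count x (x ∷ xs)      ∎))
    where open ≤-Reasoning

module _ {n : ℕ} .{{_ : NonZero n}} where

  open ≡-Reasoning

  toℕ-mod : ∀ m → toℕ (m mod n) ≡ m % n
  toℕ-mod m = toℕ-fromℕ< _

  mod-cong : ∀ {k m} → k % n ≡ m % n → k mod n ≡ m mod n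
  mod-cong {k} {m} eq = toℕ-injective (trans (toℕ-mod k) (trans eq (sym (toℕ-mod m))))

  mod-cong⁻ : ∀ {k m} → k mod n ≡ m mod n → k % n ≡ m % n
  mod-cong⁻ {k} {m} eq = trans (sym (toℕ-mod k)) (trans (cong toℕ eq) (toℕ-mod m))

  mod≡0⇒%≡0 : ∀ {k} → k mod n ≡ 0ₙ → k % n ≡ 0
  mod≡0⇒%≡0 eq = trans (mod-cong⁻ eq) (m*n%n≡0 0 n)

  mod-toℕ : ∀ (x : Zn n) → toℕ x mod n ≡ x
  mod-toℕ x = toℕ-injective (trans (toℕ-mod _) (m<n⇒m%n≡m (toℕ<n x)))

  n*k-mod : ∀ k → (n * k) mod n ≡ 0ₙ
  n*k-mod k = mod-cong (trans (cong (_% n) (*-comm n k)) (trans (m*n%n≡0 k n) (sym (m*n%n≡0 0 n))))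

  mod-+ : ∀ k m → (k mod n) +ₙ (m mod n) ≡ (k + m) mod n
  mod-+ k m = mod-cong (trans (cong₂ (λ a b → (a + b) % n) (toℕ-mod k) (toℕ-mod m)) (sym (%-distribˡ-+ k m n)))

  mod-* : ∀ k m → (k mod n) *ₙ (m mod n) ≡ (k * m) mod n
  mod-* k m = mod-cong (trans (cong₂ (λ a b → (a * b) % n) (toℕ-mod k) (toℕ-mod m)) (sym (%-distribˡ-* k m n)))

  +-modʳ : ∀ (x : Zn n) k → x +ₙ (k mod n) ≡ (toℕ x + k) mod n
  +-modʳ x k = trans (cong (_+ₙ (k mod n)) (sym (mod-toℕ x))) (mod-+ (toℕ x) k)

  *-modʳ : ∀ (x : Zn n) k → x *ₙ (k mod n) ≡ (toℕ x * k) mod n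
  *-modʳ x k = trans (cong (_*ₙ (k mod n)) (sym (mod-toℕ x))) (mod-* (toℕ x) k)

  +ₙ-comm : ∀ (x y : Zn n) → x +ₙ y ≡ y +ₙ x
  +ₙ-comm x y = cong (_mod n) (+-comm (toℕ x) (toℕ y))

  *ₙ-comm : ∀ (x y : Zn n) → x *ₙ y ≡ y *ₙ x
  *ₙ-comm x y = cong (_mod n) (*-comm (toℕ x) (toℕ y))

  +ₙ-assoc : ∀ (x y z : Zn n) → (x +ₙ y) +ₙ z ≡ x +ₙ (y +ₙ z)
  +ₙ-assoc x y z = begin
    (x +ₙ y) +ₙ z                          ≡⟨ +ₙ-comm (x +ₙ y) z ⟩
    z +ₙ (x +ₙ y)                          ≡⟨ +-modʳ z _ ⟩
    (toℕ z + (toℕ x + toℕ y)) mod n        ≡⟨ cong (_mod n) (+-comm (toℕ z) _) ⟩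
    (toℕ x + toℕ y + toℕ z) mod n          ≡⟨ cong (_mod n) (+-assoc (toℕ x) (toℕ y) (toℕ z)) ⟩
    (toℕ x + (toℕ y + toℕ z)) mod n        ≡⟨ +-modʳ x _ ⟨
    x +ₙ (y +ₙ z)                          ∎

  +ₙ-identityʳ : ∀ (x : Zn n) → x +ₙ 0ₙ ≡ x
  +ₙ-identityʳ x = trans (+-modʳ x 0) (trans (cong (_mod n) (+-identityʳ (toℕ x))) (mod-toℕ x))

  *ₙ-identityʳ : ∀ (x : Zn n) → x *ₙ 1ₙ ≡ x
  *ₙ-identityʳ x = trans (*-modʳ x 1) (trans (cong (_mod n) (*-identityʳ (toℕ x))) (mod-toℕ x))

  *ₙ-zeroʳ : ∀ (x : Zn n) → x *ₙ 0ₙ ≡ 0ₙ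
  *ₙ-zeroʳ x = trans (*-modʳ x 0) (cong (_mod n) (*-zeroʳ (toℕ x)))

  *ₙ-distribˡ-+ₙ : ∀ (x y z : Zn n) → x *ₙ (y +ₙ z) ≡ (x *ₙ y) +ₙ (x *ₙ z)
  *ₙ-distribˡ-+ₙ x y z = begin
    x *ₙ (y +ₙ z)                               ≡⟨ *-modʳ x _ ⟩
    (toℕ x * (toℕ y + toℕ z)) mod n             ≡⟨ cong (_mod n) (*-distribˡ-+ (toℕ x) (toℕ y) (toℕ z)) ⟩
    (toℕ x * toℕ y + toℕ x * toℕ z) mod n       ≡⟨ mod-+ _ _ ⟨
    (x *ₙ y) +ₙ (x *ₙ z)                        ∎

  -ₙ_ : Zn n → Zn n
  -ₙ x = (n ∸ toℕ x) mod n

  +ₙ-inverseʳ : ∀ (x : Zn n) → x +ₙ (-ₙ x) ≡ 0ₙ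
  +ₙ-inverseʳ x = begin
    x +ₙ (-ₙ x)                    ≡⟨ +-modʳ x _ ⟩
    (toℕ x + (n ∸ toℕ x)) mod n    ≡⟨ cong (_mod n) (m+[n∸m]≡n (<⇒≤ (toℕ<n x))) ⟩
    n mod n                        ≡⟨ cong (_mod n) (*-identityʳ n) ⟨
    (n * 1) mod n                  ≡⟨ n*k-mod 1 ⟩
    0ₙ                             ∎

  +ₙ-abelianGroup : AbelianGroup 0ℓ 0ℓ
  +ₙ-abelianGroup = record
    { isAbelianGroup = record
      { isGroup = record
        { isMonoid = record
          { isSemigroup = record
            { isMagma = record { isEquivalence = isEquivalence ; ∙-cong = cong₂ _+ₙ_ }
            ; assoc = +ₙ-assoc }
          ; identity = (λ x → trans (+ₙ-comm 0ₙ x) (+ₙ-identityʳ x)) , +ₙ-identityʳ }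
        ; inverse = (λ x → trans (+ₙ-comm (-ₙ x) x) (+ₙ-inverseʳ x)) , +ₙ-inverseʳ
        ; ⁻¹-cong = cong (-ₙ_) }
      ; comm = +ₙ-comm } }

  open AbelianGroup +ₙ-abelianGroup using () renaming (identityˡ to +ₙ-identityˡ)
  open AbelianGroupProperties +ₙ-abelianGroup using ()
    renaming (∙-cancelˡ to +ₙ-cancelˡ)
  open CommutativeSemigroupProperties (AbelianGroup.commutativeSemigroup +ₙ-abelianGroup)
    using () renaming (interchange to +ₙ-interchange; x∙yz≈y∙xz to x+yz≡y+xz)

  total : List (Zn n) → Zn n
  total = foldr _+ₙ_ 0ₙ

  total-++ : ∀ xs ys → total (xs ++ ys) ≡ total xs +ₙ total ys
  total-++ [] ys = sym (+ₙ-identityˡ _)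
  total-++ (x ∷ xs) ys = trans (cong (x +ₙ_) (total-++ xs ys)) (sym (+ₙ-assoc x _ _))

  total-↭ : ∀ {xs ys} → xs ↭ ys → total xs ≡ total ys
  total-↭ Perm.refl = refl
  total-↭ (prep x p) = cong (x +ₙ_) (total-↭ p)
  total-↭ (swap x y p) = trans (x+yz≡y+xz x y _) (cong (λ s → y +ₙ (x +ₙ s)) (total-↭ p))
  total-↭ (Perm.trans p q) = trans (total-↭ p) (total-↭ q)

  total-replicate : ∀ k (x : Zn n) → total (replicate k x) ≡ (k * toℕ x) mod n
  total-replicate zero x = refl
  total-replicate (suc k) x = trans (cong (x +ₙ_) (total-replicate k x)) (+-modʳ x _)

  total-shift : ∀ (x : Zn n) T → total (map (_+ₙ x) T) ≡ total T +ₙ total (replicate (length T) x)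
  total-shift x [] = sym (+ₙ-identityˡ _)
  total-shift x (t ∷ T) = trans (cong ((t +ₙ x) +ₙ_) (total-shift x T)) (+ₙ-interchange t x _ _)

  total-scale : ∀ (u : Zn n) T → total (map (u *ₙ_) T) ≡ u *ₙ total T
  total-scale u [] = sym (*ₙ-zeroʳ u)
  total-scale u (t ∷ T) = trans (cong ((u *ₙ t) +ₙ_) (total-scale u T)) (sym (*ₙ-distribˡ-+ₙ u t _))

  Unique-length : ∀ {xs : List (Zn n)} → Unique xs → length xs ≤ n
  Unique-length u = injective⇒≤ (lookup-injective u)
    where
    lookup-injective : ∀ {xs : List (Zn n)} → Unique xs → ∀ {i j} → lookup xs i ≡ lookup xs j → i ≡ j
    lookup-injective (x≢ ∷ u) {fzero} {fzero} eq = refl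
    lookup-injective (x≢ ∷ u) {fzero} {fsuc j} eq = contradiction eq (All.lookup x≢ (∈-lookup j))
    lookup-injective (x≢ ∷ u) {fsuc i} {fzero} eq = contradiction (sym eq) (All.lookup x≢ (∈-lookup i))
    lookup-injective (x≢ ∷ u) {fsuc i} {fsuc j} eq = cong fsuc (lookup-injective u eq)

  open DecMembership (_≟_ {n}) using (_∈?_)

  +ₙ-multiples : ∀ b A → 0ₙ ∈ A → (∀ {a} → a ∈ A → a +ₙ b ∈ A) → ∀ k → total (replicate k b) ∈ A
  +ₙ-multiples b A 0∈A closed zero = 0∈A
  +ₙ-multiples b A 0∈A closed (suc k) =
    subst (_∈ A) (+ₙ-comm _ b) (closed (+ₙ-multiples b A 0∈A closed k))

  total-replicate-n : ∀ (x : Zn n) → total (replicate n x) ≡ 0ₙ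
  total-replicate-n x = trans (total-replicate n x) (n*k-mod (toℕ x))

  -- If A + b ⊆ A, then A contains every multiple of b, in particular −b.
  escape : ∀ b A → 0ₙ ∈ A → (∃[ a ] (a ∈ A × a +ₙ b ≡ 0ₙ)) ⊎ (∃[ a ] (a ∈ A × a +ₙ b ∉ A))
  escape b A 0∈A with any? (λ a → ¬? (a +ₙ b ∈? A)) A
  ... | yes p with a , a∈A , a+b∉A ← find p = inj₂ (a , a∈A , a+b∉A)
  ... | no ¬p = inj₁ (total (replicate (n ∸ 1) b) , +ₙ-multiples b A 0∈A closed (n ∸ 1) , (begin
      total (replicate (n ∸ 1) b) +ₙ b     ≡⟨ +ₙ-comm _ b ⟩
      total (replicate (suc (n ∸ 1)) b)    ≡⟨ cong (λ k → total (replicate k b)) (suc-pred n) ⟩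
      total (replicate n b)                ≡⟨ total-replicate-n b ⟩
      0ₙ                                   ∎))
    where
    closed : ∀ {a} → a ∈ A → a +ₙ b ∈ A
    closed {a} a∈A with a +ₙ b ∈? A
    ... | yes q = q
    ... | no ¬q = contradiction (lose a∈A ¬q) ¬p

  IsSum : List (Zn n) → List (Zn n) → Zn n → Set
  IsSum A B d = ∃₂ λ a b → a ∈ A × b ∈ B × d ≡ a +ₙ b

  -- Scherk's theorem for A and B ∪ {0}, by Dyson's e-transform at a: the elements c of B with
  -- a + c ∉ A leave B, and the sums a + c join A. The choice of a makes B strictly smaller.
  scherk : ∀ B A → Acc _<_ (length B) → Unique A → 0ₙ ∈ A → Unique B →
    IsSum A B 0ₙ ⊎
    (∃[ D ] (Unique D × 0ₙ ∈ D × length D ≡ length A + length B ×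
      (∀ d → d ∈ D → d ∈ A ⊎ IsSum A B d)))
  scherk [] A _ uA 0∈A _ = inj₂ (A , uA , 0∈A , sym (+-identityʳ _) , λ _ → inj₁)
  scherk B@(b ∷ _) A (acc rs) uA 0∈A uB with escape b A 0∈A
  ... | inj₁ (a , a∈A , eq) = inj₁ (a , b , a∈A , here refl , sym eq)
  ... | inj₂ (a , a∈A , a+b∉A) = conclude (scherk B⁺ A⁺ (rs shorter) uA⁺ (∈-++⁺ˡ 0∈A) (Unique.filter⁺ inA? uB))
    where
    inA? : ∀ c → _
    inA? c = a +ₙ c ∈? A
    B⁺ = filter inA? B
    B⁻ = filter (λ c → ¬? (inA? c)) B
    A⁺ = A ++ map (a +ₙ_) B⁻

    size : length B ≡ length B⁺ + length B⁻
    size = trans (↭-length (filter-split inA? B)) (length-++ B⁺)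

    shorter : length B⁺ < length B
    shorter = subst (length B⁺ <_) (sym size)
      (m<m+n (length B⁺) (∈-length (∈-filter⁺ (λ c → ¬? (inA? c)) (here refl) a+b∉A)))

    uA⁺ : Unique A⁺
    uA⁺ = Unique.++⁺ uA (Unique.map⁺ (+ₙ-cancelˡ a _ _) (Unique.filter⁺ (λ c → ¬? (inA? c)) uB))
      λ { (x∈A , x∈) → let c , c∈ , eq = ∈-map⁻ (a +ₙ_) x∈ in
          proj₂ (∈-filter⁻ (λ c → ¬? (inA? c)) {xs = B} c∈) (subst (_∈ A) eq x∈A) }

    A⁺-sum : ∀ {x} → x ∈ A⁺ → x ∈ A ⊎ IsSum A B x
    A⁺-sum x∈ with ∈-++⁻ A x∈
    ... | inj₁ x∈A = inj₁ x∈A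
    ... | inj₂ x∈′ with c , c∈ , eq ← ∈-map⁻ (a +ₙ_) x∈′ =
      inj₂ (a , c , a∈A , proj₁ (∈-filter⁻ (λ c → ¬? (inA? c)) {xs = B} c∈) , eq)

    -- (a + c) + c′ = (a + c′) + c, and a + c′ ∈ A by the choice of B⁺.
    A⁺+B⁺-sum : ∀ {x c′} → x ∈ A⁺ → c′ ∈ B⁺ → IsSum A B (x +ₙ c′)
    A⁺+B⁺-sum {x} {c′} x∈ c′∈ with ∈-++⁻ A x∈ | ∈-filter⁻ inA? {xs = B} c′∈
    ... | inj₁ x∈A | c′∈B , _ = x , c′ , x∈A , c′∈B , refl
    ... | inj₂ x∈′ | _ , a+c′∈A with c , c∈ , refl ← ∈-map⁻ (a +ₙ_) x∈′ =
      a +ₙ c′ , c , a+c′∈A , proj₁ (∈-filter⁻ (λ c → ¬? (inA? c)) {xs = B} c∈) ,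
      trans (+ₙ-assoc a c c′) (trans (cong (a +ₙ_) (+ₙ-comm c c′)) (sym (+ₙ-assoc a c′ c)))

    conclude :
      IsSum A⁺ B⁺ 0ₙ ⊎
      (∃[ D ] (Unique D × 0ₙ ∈ D × length D ≡ length A⁺ + length B⁺ ×
        (∀ d → d ∈ D → d ∈ A⁺ ⊎ IsSum A⁺ B⁺ d))) → _
    conclude (inj₁ (x , c , x∈ , c∈ , eq)) = inj₁ (subst (IsSum A B) (sym eq) (A⁺+B⁺-sum x∈ c∈))
    conclude (inj₂ (D , uD , 0∈D , len , sums)) = inj₂ (D , uD , 0∈D , trans len len′ , sums′)
      where
      len′ : length A⁺ + length B⁺ ≡ length A + length B
      len′ = begin
        length A⁺ + length B⁺                    ≡⟨ cong (_+ length B⁺) (trans (length-++ A) (cong (length A +_) (length-map _ B⁻))) ⟩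
        (length A + length B⁻) + length B⁺       ≡⟨ +-assoc (length A) _ _ ⟩
        length A + (length B⁻ + length B⁺)       ≡⟨ cong (length A +_) (trans (+-comm (length B⁻) _) (sym size)) ⟩
        length A + length B                      ∎
      sums′ : ∀ d → d ∈ D → d ∈ A ⊎ IsSum A B d
      sums′ d d∈ with sums d d∈
      ... | inj₁ d∈A⁺ = A⁺-sum d∈A⁺
      ... | inj₂ (x , c , x∈ , c∈ , refl) = inj₂ (A⁺+B⁺-sum x∈ c∈)

module _ {n : ℕ} .{{_ : NonZero n}} where

  open AbelianGroupProperties (+ₙ-abelianGroup {n}) using ()
    renaming (∙-cancelʳ to +ₙ-cancelʳ)
  open DecMembership (_≟_ {n}) using (_∈?_)
  open Multiplicity (_≟_ {n})

  ZeroSum : List (Zn n) → ℕ → Set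
  ZeroSum L l = ∃[ U ] (U ≼ L × 1 ≤ length U × length U ≤ l × total U ≡ 0ₙ)

  Represents : List (Zn n) → ℕ → Zn n → Set
  Represents L l x = ∃[ U ] (U ≼ L × length U ≤ l × total U ≡ x)

  Represents-weaken : ∀ {L l x} M → Represents L l x → Represents (L ++ M) (l + 1) x
  Represents-weaken M (U , (V , p) , le , eq) =
    U , (V ++ M , ↭-trans (++⁺ p ↭-refl) (↭-reflexive (++-assoc U V M))) , ≤-trans le (m≤m+n _ 1) , eq

  Represents-extend : ∀ {L l x M b} → Represents L l x → b ∈ M →
    Σ[ U ∈ List (Zn n) ] (U ≼ L ++ M × 1 ≤ length U × length U ≤ l + 1 × total U ≡ x +ₙ b)
  Represents-extend {l = l} {x} {b = b} (U , U≼L , le , eq) b∈M =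
    U ++ [ b ] , ++-mono-≼ U≼L (⊆⇒≼ (from∈ b∈M)) ,
    ≤-trans (m≤n+m 1 (length U)) (≤-reflexive (sym (length-++ U))) ,
    ≤-trans (≤-reflexive (length-++ U)) (+-monoˡ-≤ 1 le) ,
    trans (total-++ U [ b ]) (cong₂ _+ₙ_ eq (+ₙ-identityʳ b))

  ZeroSum-≼ : ∀ {L M l m} → L ≼ M → l ≤ m → ZeroSum L l → ZeroSum M m
  ZeroSum-≼ (C , q) l≤m (U , (V , p) , ge , le , eq) =
    U , (V ++ C , ↭-trans q (↭-trans (++⁺ p ↭-refl) (↭-reflexive (++-assoc U V C)))) , ge , ≤-trans le l≤m , eq

  blocks-zeroSum : ∀ Cs L l A → Unique A → 0ₙ ∈ A → (∀ x → x ∈ A → Represents L l x) → All Unique Cs →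
    n < length A + length (concat Cs) → ZeroSum (L ++ concat Cs) (l + length Cs)
  blocks-zeroSum [] L l A uA 0∈A rep [] lt =
    contradiction (Unique-length uA) (<⇒≱ (subst (n <_) (+-identityʳ _) lt))
  blocks-zeroSum (C ∷ Cs) L l A uA 0∈A rep (uC ∷ uCs) lt with scherk C A (<-wellFounded _) uA 0∈A uC
  ... | inj₁ (a , b , a∈A , b∈C , eq) with U , U≼ , ge , le , tot ← Represents-extend (rep a a∈A) b∈C =
    ZeroSum-≼ (concat Cs , ↭-reflexive (sym (++-assoc L C (concat Cs)))) (+-monoʳ-≤ l (s≤s z≤n))
      (U , U≼ , ge , le , trans tot (sym eq))
  ... | inj₂ (D , uD , 0∈D , len , sums) =
    ZeroSum-≼ ([] , ↭-reflexive (trans (sym (++-assoc L C (concat Cs))) (sym (++-identityʳ _))))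
      (≤-reflexive (+-assoc l 1 (length Cs)))
      (blocks-zeroSum Cs (L ++ C) (l + 1) D uD 0∈D rep′ uCs lt′)
    where
    rep′ : ∀ d → d ∈ D → Represents (L ++ C) (l + 1) d
    rep′ d d∈D with sums d d∈D
    ... | inj₁ d∈A = Represents-weaken C (rep d d∈A)
    ... | inj₂ (a , b , a∈A , b∈C , eq) with U , U≼ , _ , le , tot ← Represents-extend (rep a a∈A) b∈C =
      U , U≼ , le , trans tot (sym eq)
    lt′ : n < length D + length (concat Cs)
    lt′ = subst (n <_) (begin
      length A + length (C ++ concat Cs)            ≡⟨ cong (length A +_) (length-++ C) ⟩
      length A + (length C + length (concat Cs))    ≡⟨ +-assoc (length A) _ _ ⟨
      length A + length C + length (concat Cs)      ≡⟨ cong (_+ length (concat Cs)) len ⟨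
      length D + length (concat Cs)                 ∎) lt
      where open ≡-Reasoning

  short-zeroSum : ∀ h R → (∀ x → count x R ≤ h) → n ≤ length R → ZeroSum R h
  short-zeroSum h R bd n≤R with Bs , refl , us , p ← set-partition h R bd =
    ZeroSum-≼ ([] , ↭-trans (↭-sym p) (↭-reflexive (sym (++-identityʳ _)))) ≤-refl
      (blocks-zeroSum Bs [] 0 [ 0ₙ ] ([] ∷ []) (here refl) rep us (s≤s (≤-trans n≤R (≤-reflexive (sym (↭-length p))))))
    where
    rep : ∀ x → x ∈ [ 0ₙ ] → Represents [] 0 x
    rep x (here refl) = [] , ([] , ↭-refl) , z≤n , refl

  pair-≼ : ∀ {a b : Zn n} {B} → a ∈ B → b ∈ B → a ≢ b → (a ∷ b ∷ []) ≼ B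
  pair-≼ (here refl) (here refl) a≢b = contradiction refl a≢b
  pair-≼ {a} (here refl) (there b∈) a≢b with C , p ← ⊆⇒≼ (from∈ b∈) = C , prep a p
  pair-≼ {a} {b} (there a∈) (here refl) a≢b with C , p ← ⊆⇒≼ (from∈ a∈) = C , ↭-trans (prep b p) (swap b a ↭-refl)
  pair-≼ {a} {b} {x ∷ B} (there a∈) (there b∈) a≢b with C , p ← pair-≼ a∈ b∈ a≢b =
    x ∷ C , ↭-trans (prep x p) (↭-sym (shift x (a ∷ b ∷ []) C))

  extremes : ∀ {x y : Zn n} {B} → x ∈ B → y ∈ B → x ≢ y → ∃₂ λ a b → a ∈ B × b ∈ B × a ≢ b ×
    (∀ c → c ∈ B → toℕ b ≤ toℕ c × toℕ c ≤ toℕ a)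
  extremes {x} {y} {B} x∈ y∈ x≢y = a , b , a∈ , b∈ , a≢b , bounds
    where
    a = argmax toℕ x B
    b = argmin toℕ x B
    a∈ : a ∈ B
    a∈ with argmax-sel toℕ x B
    ... | inj₁ eq = subst (_∈ B) (sym eq) x∈
    ... | inj₂ p = p
    b∈ : b ∈ B
    b∈ with argmin-sel toℕ x B
    ... | inj₁ eq = subst (_∈ B) (sym eq) x∈
    ... | inj₂ p = p
    bounds : ∀ c → c ∈ B → toℕ b ≤ toℕ c × toℕ c ≤ toℕ a
    bounds c c∈ = All.lookup (f[argmin]≤f[xs] x B) c∈ , All.lookup (f[xs]≤f[argmax] x B) c∈
    a≢b : a ≢ b
    a≢b eq = x≢y (trans (all≡b x∈) (sym (all≡b y∈)))
      where
      all≡b : ∀ {c} → c ∈ B → c ≡ b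
      all≡b {c} c∈ = toℕ-injective (≤-antisym
        (≤-trans (proj₂ (bounds c c∈)) (≤-reflexive (cong toℕ eq))) (proj₁ (bounds c c∈)))

  -- If a + b does not wrap around it exceeds a = max B, and otherwise it is below b = min B.
  max+min∉ : ∀ {a b : Zn n} {B} → b ≢ 0ₙ → (∀ c → c ∈ B → toℕ b ≤ toℕ c × toℕ c ≤ toℕ a) → a +ₙ b ∉ B
  max+min∉ {a} {b} b≢0 bounds a+b∈B with toℕ a + toℕ b <? n
  ... | yes lt = <⇒≱ (m<m+n (toℕ a) b>0) (≤-trans (≤-reflexive (sym toℕ-a+b)) (proj₂ (bounds _ a+b∈B)))
    where
    toℕ-a+b : toℕ (a +ₙ b) ≡ toℕ a + toℕ b
    toℕ-a+b = trans (toℕ-mod _) (m<n⇒m%n≡m lt)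
    b>0 : 0 < toℕ b
    b>0 = n≢0⇒n>0 λ eq → b≢0 (trans (sym (mod-toℕ b)) (cong (_mod n) eq))
  ... | no nlt = <⇒≱ below (≤-trans (proj₁ (bounds _ a+b∈B)) (≤-reflexive (toℕ-mod _)))
    where
    n≤a+b : n ≤ toℕ a + toℕ b
    n≤a+b = ≮⇒≥ nlt
    below : (toℕ a + toℕ b) % n < toℕ b
    below = begin-strict
      (toℕ a + toℕ b) % n           ≡⟨ m≤n⇒[n∸m]%m≡n%m n≤a+b ⟨
      (toℕ a + toℕ b ∸ n) % n       ≤⟨ m%n≤m _ n ⟩
      toℕ a + toℕ b ∸ n             <⟨ ∸-monoˡ-< (+-monoˡ-< (toℕ b) (toℕ<n a)) n≤a+b ⟩
      n + toℕ b ∸ n                 ≡⟨ m+n∸m≡n n (toℕ b) ⟩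
      toℕ b                         ∎
      where open ≤-Reasoning

  -- Adding a + b to B for suitable a, b ∈ B gains one element at the cost of one more summand.
  gaining-zeroSum : ∀ {x y : Zn n} {B} Bs → Unique B → x ∈ B → y ∈ B → x ≢ y → All Unique Bs →
    n ≤ suc (length B + length (concat Bs)) → ZeroSum (B ++ concat Bs) (2 + length Bs)
  gaining-zeroSum {B = B} Bs uB x∈ y∈ x≢y uBs n≤
    with a , b , a∈ , b∈ , a≢b , bounds ← extremes x∈ y∈ x≢y
    with 0ₙ ∈? B
  ... | yes 0∈B = [ 0ₙ ] , ++-mono-≼ (⊆⇒≼ (from∈ 0∈B)) (concat Bs , ↭-refl) , ≤-refl , s≤s z≤n , +ₙ-identityʳ 0ₙ
  ... | no 0∉B with (a +ₙ b) ≟ 0ₙ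
  ...   | yes a+b≡0 = a ∷ b ∷ [] , ++-mono-≼ (pair-≼ a∈ b∈ a≢b) (concat Bs , ↭-refl) , s≤s z≤n , s≤s (s≤s z≤n) ,
    trans (cong (a +ₙ_) (+ₙ-identityʳ b)) a+b≡0
  ...   | no a+b≢0 = blocks-zeroSum Bs B 2 (0ₙ ∷ (a +ₙ b) ∷ B) unique (here refl) rep uBs (s≤s n≤)
    where
    unique : Unique (0ₙ ∷ (a +ₙ b) ∷ B)
    unique = ((λ eq → a+b≢0 (sym eq)) ∷ ¬Any⇒All¬ B 0∉B) ∷
      ¬Any⇒All¬ B (max+min∉ (λ eq → 0∉B (subst (_∈ B) eq b∈)) bounds) ∷ uB
    rep : ∀ c → c ∈ 0ₙ ∷ (a +ₙ b) ∷ B → Represents B 2 c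
    rep c (here refl) = [] , (B , ↭-refl) , z≤n , refl
    rep c (there (here refl)) = a ∷ b ∷ [] , pair-≼ a∈ b∈ a≢b , ≤-refl , cong (a +ₙ_) (+ₙ-identityʳ b)
    rep c (there (there c∈)) = [ c ] , ⊆⇒≼ (from∈ c∈) , s≤s z≤n , +ₙ-identityʳ c

  cancel-middle : ∀ u m k {c} → u + c ≡ m + (u + k) → c ≡ m + k
  cancel-middle u m k eq = +-cancelˡ-≡ u _ _ (trans eq (x∙yz≈y∙xz m u k))
    where open CommutativeSemigroupProperties +-commutativeSemigroup using (x∙yz≈y∙xz)

  extract : ∀ h m R → Acc _<_ m → (∀ x → count x R ≤ h) → length R ≡ n + m →
    ∃₂ λ W C → R ↭ W ++ C × total W ≡ 0ₙ × suc m ≤ length W × length W ≤ m + h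
  extract h m R (acc rs) bd len
    with U , (C , p) , ge , le , eq ← short-zeroSum h R bd (≤-trans (m≤m+n n m) (≤-reflexive (sym len)))
    with m <? length U
  ... | yes m<U = U , C , p , eq , m<U , ≤-trans le (m≤n+m h m)
  ... | no m≮U with k , refl ← m≤n⇒∃[o]m+o≡n (≮⇒≥ m≮U)
    with W , C′ , p′ , eq′ , ge′ , le′ ← extract h k C (rs (m<n+m k ge))
           (λ x → ≤-trans (count-mono x (U , ↭-trans p (Perm.↭-sym (++-comm C U)))) (bd x))
           (cancel-middle (length U) n k (trans (sym (length-++ U)) (trans (sym (↭-length p)) len))) =
    U ++ W , C′ , ↭-trans p (↭-trans (++⁺ˡ U p′) (↭-reflexive (sym (++-assoc U W C′)))) ,
    trans (total-++ U W) (trans (cong₂ _+ₙ_ eq eq′) (+ₙ-identityʳ 0ₙ)) ,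
    ≤-trans (≤-reflexive (sym (+-suc (length U) k))) (≤-trans (+-monoʳ-≤ (length U) ge′) (≤-reflexive (sym (length-++ U)))) ,
    ≤-trans (≤-reflexive (length-++ U)) (≤-trans (+-monoʳ-≤ (length U) le′) (≤-reflexive (sym (+-assoc (length U) k h))))

  HasZeroSumₙ : List (Zn n) → Set
  HasZeroSumₙ S = ∃[ T ] (T ⊆ S × length T ≡ n × total T ≡ 0ₙ)

  ≼⇒HasZeroSumₙ : ∀ {T S} → T ≼ S → length T ≡ n → total T ≡ 0ₙ → HasZeroSumₙ S
  ≼⇒HasZeroSumₙ T≼S len eq with T′ , T′⊆S , p ← ≼⇒⊆ T≼S =
    T′ , T′⊆S , trans (↭-length p) len , trans (total-↭ p) eq

  HasZeroSumₙ-↭ : ∀ {S S′} → S ↭ S′ → HasZeroSumₙ S → HasZeroSumₙ S′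
  HasZeroSumₙ-↭ p (T , T⊆S , len , eq) = ≼⇒HasZeroSumₙ (≼-resp-↭ (⊆⇒≼ T⊆S) p) len eq

  HasZeroSumₙ-⊆ : ∀ {S S′} → S ⊆ S′ → HasZeroSumₙ S → HasZeroSumₙ S′
  HasZeroSumₙ-⊆ S⊆S′ (T , T⊆S , len , eq) = T , ⊆-trans T⊆S S⊆S′ , len , eq

  HasZeroSumₙ-shift : ∀ x {S} → HasZeroSumₙ S → HasZeroSumₙ (map (_+ₙ x) S)
  HasZeroSumₙ-shift x (T , T⊆S , len , eq) =
    map (_+ₙ x) T , Sub.map⁺ (_+ₙ x) T⊆S , trans (length-map (_+ₙ x) T) len ,
    trans (total-shift x T) (trans (cong₂ _+ₙ_ eq
      (trans (cong (λ k → total (replicate k x)) len) (total-replicate-n x))) (+ₙ-identityʳ 0ₙ))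

  HasZeroSumₙ-scale : ∀ u {S} → HasZeroSumₙ S → HasZeroSumₙ (map (u *ₙ_) S)
  HasZeroSumₙ-scale u (T , T⊆S , len , eq) =
    map (u *ₙ_) T , Sub.map⁺ (u *ₙ_) T⊆S , trans (length-map (u *ₙ_) T) len ,
    trans (total-scale u T) (trans (cong (u *ₙ_) eq) (*ₙ-zeroʳ u))

  +ₙ-undo : ∀ x (y : Zn n) → (y +ₙ x) +ₙ (-ₙ x) ≡ y
  +ₙ-undo x y = trans (+ₙ-assoc y x _) (trans (cong (y +ₙ_) (+ₙ-inverseʳ x)) (+ₙ-identityʳ y))

  map-+ₙ-undo : ∀ x (S : List (Zn n)) → map (_+ₙ (-ₙ x)) (map (_+ₙ x) S) ≡ S
  map-+ₙ-undo x S = trans (sym (map-∘ S)) (trans (map-cong (+ₙ-undo x) S) (map-id S))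

  HasZeroSumₙ-unshift : ∀ x {S} → HasZeroSumₙ (map (_+ₙ x) S) → HasZeroSumₙ S
  HasZeroSumₙ-unshift x {S} z = subst HasZeroSumₙ (map-+ₙ-undo x S) (HasZeroSumₙ-shift (-ₙ x) z)

  pad : ∀ h {R W} → W ≼ R → total W ≡ 0ₙ → length W ≤ n → n ≤ h + length W →
    HasZeroSumₙ (replicate h 0ₙ ++ R)
  pad h {R} {W} W≼R eq W≤n n≤h+W = ≼⇒HasZeroSumₙ
    (++-mono-≼ (replicate-mono-≼ 0ₙ k≤h) W≼R)
    (trans (length-++ (replicate k 0ₙ)) (trans (cong (_+ length W) (length-replicate k)) (m∸n+n≡m W≤n)))
    (trans (total-++ (replicate k 0ₙ) W) (trans (cong₂ _+ₙ_ zeros eq) (+ₙ-identityʳ 0ₙ)))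
    where
    k = n ∸ length W
    k≤h : k ≤ h
    k≤h = m≤n+o⇒m∸n≤o n (length W) (subst (n ≤_) (+-comm h (length W)) n≤h+W)
    zeros : total (replicate k 0ₙ) ≡ 0ₙ
    zeros = begin
      total (replicate k 0ₙ)       ≡⟨ total-replicate k 0ₙ ⟩
      (k * toℕ 0ₙ) mod n           ≡⟨ cong (λ z → (k * z) mod n) (trans (toℕ-mod 0) (m*n%n≡0 0 n)) ⟩
      (k * 0) mod n                ≡⟨ cong (_mod n) (*-zeroʳ k) ⟩
      0ₙ                           ∎
      where open ≡-Reasoning

  zeros-suffice : ∀ h R → n ≤ h → HasZeroSumₙ (replicate h 0ₙ ++ R)
  zeros-suffice h R n≤h = pad h (R , ↭-refl) refl z≤n (≤-trans n≤h (m≤m+n h 0))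

  NormalForm : List (Zn n) → Set
  NormalForm S = ∃₂ λ h z → ∃[ R ] ((∀ x → count x R ≤ h) × map (_+ₙ z) S ↭ replicate h 0ₙ ++ R)

  normalise : ∀ (S : List (Zn n)) → NormalForm S
  normalise S = h , -ₙ z , map (_+ₙ (-ₙ z)) Q , bd , perm
    where
    z = argmax (λ x → count x S) 0ₙ (allFin n)
    h = count z S
    Q = filter (λ x → ¬? (z ≟ x)) S
    maximal : ∀ x → count x S ≤ h
    maximal x = All.lookup (f[xs]≤f[argmax] 0ₙ (allFin n)) (∈-allFin x)
    split : S ↭ replicate h z ++ Q
    split = ↭-trans (filter-split (z ≟_) S)
      (↭-reflexive (cong (_++ Q) (replicate-unfold (All.tabulate (λ x∈ → proj₂ (∈-filter⁻ (z ≟_) {xs = S} x∈))))))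
    bd : ∀ x → count x (map (_+ₙ (-ₙ z)) Q) ≤ h
    bd x = ≤-trans (≤-reflexive (trans (cong (λ y → count y (map (_+ₙ (-ₙ z)) Q)) (sym (+ₙ-undo z x)))
                     (count-map (+ₙ-cancelʳ (-ₙ z) _ _) (x +ₙ z) Q)))
             (≤-trans (count-mono (x +ₙ z) (⊆⇒≼ (Sub.filter-⊆ (λ x → ¬? (z ≟ x)) S))) (maximal (x +ₙ z)))
    perm : map (_+ₙ (-ₙ z)) S ↭ replicate h 0ₙ ++ map (_+ₙ (-ₙ z)) Q
    perm = ↭-trans (map⁺ (_+ₙ (-ₙ z)) split) (↭-reflexive (begin
      map (_+ₙ (-ₙ z)) (replicate h z ++ Q)                             ≡⟨ map-++ (_+ₙ (-ₙ z)) (replicate h z) Q ⟩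
      map (_+ₙ (-ₙ z)) (replicate h z) ++ map (_+ₙ (-ₙ z)) Q
        ≡⟨ cong (_++ map (_+ₙ (-ₙ z)) Q) (trans (map-replicate (_+ₙ (-ₙ z)) h z) (cong (replicate h) (+ₙ-inverseʳ z))) ⟩
      replicate h 0ₙ ++ map (_+ₙ (-ₙ z)) Q                              ∎))
      where open ≡-Reasoning

  coprime⇒unit : ∀ (g : Zn n) → Bézout.Identity 1 (toℕ g) n → IsUnit g
  coprime⇒unit g (Bézout.+- x y eq) = x mod n , (begin
    g *ₙ (x mod n)         ≡⟨ *-modʳ g x ⟩
    (toℕ g * x) mod n      ≡⟨ cong (_mod n) (trans (*-comm (toℕ g) x) (sym eq)) ⟩
    (1 + y * n) mod n      ≡⟨ mod-cong ([m+kn]%n≡m%n 1 y n) ⟩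
    1ₙ                     ∎)
    where open ≡-Reasoning
  -- Here g x ≡ −1, so the inverse is (n − 1) x.
  coprime⇒unit g (Bézout.-+ x y eq) = (x * (n ∸ 1)) mod n , (begin
    g *ₙ ((x * (n ∸ 1)) mod n)                          ≡⟨ *-modʳ g _ ⟩
    (toℕ g * (x * (n ∸ 1))) mod n                       ≡⟨ mod-cong ([m+kn]%n≡m%n _ y n) ⟨
    (toℕ g * (x * (n ∸ 1)) + y * n) mod n               ≡⟨ cong (λ t → (toℕ g * (x * (n ∸ 1)) + t) mod n) eq ⟨
    (toℕ g * (x * (n ∸ 1)) + (1 + x * toℕ g)) mod n     ≡⟨ cong (_mod n) (rearrange (toℕ g) x (n ∸ 1)) ⟩
    (1 + (x * toℕ g) * suc (n ∸ 1)) mod n               ≡⟨ cong (λ t → (1 + (x * toℕ g) * t) mod n) (suc-pred n) ⟩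
    (1 + (x * toℕ g) * n) mod n                         ≡⟨ mod-cong ([m+kn]%n≡m%n 1 (x * toℕ g) n) ⟩
    1ₙ                                                  ∎)
    where
    open ≡-Reasoning
    rearrange : ∀ g x p → g * (x * p) + (1 + x * g) ≡ 1 + (x * g) * suc p
    rearrange = solve-∀

  unit-or-torsion : ∀ (g : Zn n) → IsUnit g ⊎ ∃[ k ] (1 ≤ k × k < n × total (replicate k g) ≡ 0ₙ)
  unit-or-torsion g = cases (gcd (toℕ g) n) refl (gcd[m,n]∣m (toℕ g) n) (gcd[m,n]∣n (toℕ g) n)
    where
    cases : ∀ d → gcd (toℕ g) n ≡ d → d ∣ toℕ g → d ∣ n →
      IsUnit g ⊎ ∃[ k ] (1 ≤ k × k < n × total (replicate k g) ≡ 0ₙ)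
    cases 1 d≡ _ _ = inj₁ (coprime⇒unit g (coprime-Bézout (gcd≡1⇒coprime d≡)))
    cases 0 _ _ (divides k n≡) = contradiction (trans n≡ (*-zeroʳ k)) (≢-nonZero⁻¹ n)
    cases _ _ _ (divides zero n≡) = contradiction n≡ (≢-nonZero⁻¹ n)
    cases d@(suc (suc _)) _ (divides q g≡) (divides k@(suc _) n≡) =
      inj₂ (k , s≤s z≤n , subst (k <_) (sym n≡) (m<m*n k d (s≤s (s≤s z≤n))) , (begin
        total (replicate k g)    ≡⟨ total-replicate k g ⟩
        (k * toℕ g) mod n        ≡⟨ cong (λ t → (k * t) mod n) g≡ ⟩
        (k * (q * d)) mod n      ≡⟨ cong (_mod n) (trans (rearrange k q d) (cong (_* q) (sym n≡))) ⟩
        (n * q) mod n            ≡⟨ n*k-mod q ⟩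
        0ₙ                       ∎))
      where
      open ≡-Reasoning
      rearrange : ∀ k q d → k * (q * d) ≡ (k * d) * q
      rearrange = solve-∀

  module _ {p : ℕ} (n≡1+p : n ≡ suc p) where

    Tight : ℕ → List (Zn n) → Set
    Tight h R = ∃₂ λ W C → R ↭ W ++ C × total W ≡ 0ₙ × h + length W ≡ p

    tight-length : ∀ {k} h m r → h + r ≡ (h + suc m) + (h + suc m) → k ≡ suc (h + suc m) → r ≡ k + m
    tight-length h m r eq refl = +-cancelˡ-≡ h _ _ (trans eq (rearrange h m))
      where
      rearrange : ∀ h m → (h + suc m) + (h + suc m) ≡ h + (suc (h + suc m) + m)
      rearrange = solve-∀

    tight : ∀ h R → h ≤ p → (∀ x → count x R ≤ h) → h + length R ≡ p + p →
      HasZeroSumₙ (replicate h 0ₙ ++ R) ⊎ Tight h R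
    tight h R h≤p bd len with m≤n⇒∃[o]m+o≡n h≤p
    ... | zero , h+0≡p = inj₂ ([] , R , ↭-refl , refl , h+0≡p)
    ... | suc m , refl with W , C , q , eq , ge , le ← extract h m R (<-wellFounded m) bd (tight-length h m (length R) len n≡1+p)
                       with n ≤? h + length W
    ...   | yes n≤ = inj₁ (pad h (C , q) eq (begin
              length W        ≤⟨ le ⟩
              m + h           ≡⟨ +-comm m h ⟩
              h + m           ≤⟨ +-monoʳ-≤ h (n≤1+n m) ⟩
              h + suc m       ≤⟨ n≤1+n _ ⟩
              suc (h + suc m) ≡⟨ n≡1+p ⟨
              n               ∎) n≤)
      where open ≤-Reasoning
    ...   | no n≰ = inj₂ (W , C , q , eq , ≤-antisym
              (≤-pred (subst (h + length W <_) n≡1+p (≰⇒> n≰)))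
              (+-monoʳ-≤ h ge))

    combine : ∀ {h R} W {C} → R ↭ W ++ C → total W ≡ 0ₙ → h + length W ≡ p → ZeroSum C (suc h) →
      HasZeroSumₙ (replicate h 0ₙ ++ R)
    combine {h} W q eq h+W≡p (U , U≼C , ge , le , eq′) = pad h
      (≼-resp-↭ (++-mono-≼ ([] , ↭-reflexive (sym (++-identityʳ W))) U≼C) (↭-sym q))
      (trans (total-++ W U) (trans (cong₂ _+ₙ_ eq eq′) (+ₙ-identityʳ 0ₙ)))
      (begin
        length (W ++ U)            ≡⟨ length-++ W ⟩
        length W + length U        ≤⟨ +-monoʳ-≤ (length W) le ⟩
        length W + suc h           ≡⟨ +-comm (length W) (suc h) ⟩
        suc (h + length W)         ≡⟨ n≡ ⟨
        n                          ∎)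
      (begin
        n                          ≡⟨ n≡ ⟩
        suc (h + length W)         ≡⟨ +-suc h (length W) ⟨
        h + suc (length W)         ≡⟨ cong (h +_) (+-comm 1 (length W)) ⟩
        h + (length W + 1)         ≤⟨ +-monoʳ-≤ h (+-monoʳ-≤ (length W) ge) ⟩
        h + (length W + length U)  ≡⟨ cong (h +_) (length-++ W) ⟨
        h + length (W ++ U)        ∎)
      where
      open ≤-Reasoning
      n≡ : n ≡ suc (h + length W)
      n≡ = trans n≡1+p (cong suc (sym h+W≡p))

    nonconstant-zeroSum : ∀ h C → h < p → (∀ x → count x C ≤ h) → length C ≡ p → ZeroSum C (suc h)
    nonconstant-zeroSum h C h<p bd len with Bs , refl , uBs , q ← set-partition h C bd
      with large-block Bs uBs (subst (length Bs <_) (sym (trans (↭-length q) len)) h<p)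
    ... | (x ∷ y ∷ B) , Bs′ , uB@((x≢y ∷ _) ∷ _) , _ , uBs′ , h≡ , q′ =
      ZeroSum-≼ ([] , ↭-trans (↭-sym (↭-trans q′ q)) (↭-reflexive (sym (++-identityʳ _))))
        (≤-reflexive (cong suc (sym h≡)))
        (gaining-zeroSum Bs′ uB (here refl) (there (here refl)) x≢y uBs′ (≤-reflexive (begin
          n                                                   ≡⟨ n≡1+p ⟩
          suc p                                               ≡⟨ cong suc (trans (↭-length (↭-trans q′ q)) len) ⟨
          suc (length ((x ∷ y ∷ B) ++ concat Bs′))            ≡⟨ cong suc (length-++ (x ∷ y ∷ B)) ⟩
          suc (length (x ∷ y ∷ B) + length (concat Bs′))      ∎)))
      where open ≡-Reasoning
    ... | [] , _ , _ , () , _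
    ... | (_ ∷ []) , _ , _ , s≤s () , _

    constant? : ∀ C → length C ≡ p → ZeroSum C (suc p) ⊎ (∃[ g ] C ≡ replicate p g)
    constant? [] len = inj₂ (0ₙ , cong (λ k → replicate k 0ₙ) len)
    constant? (x ∷ D) len with All.all? (x ≟_) D
    ... | yes x≡ = inj₂ (x , trans (replicate-unfold (refl ∷ x≡)) (cong (λ k → replicate k x) len))
    ... | no x≢ with y , y∈D , x≢y ← find (¬All⇒Any¬ (x ≟_) D x≢)
                with E , q ← ⊆⇒≼ (from∈ y∈D)
                with 2+E≡p ← trans (cong suc (sym (↭-length q))) len = inj₁
      (ZeroSum-≼ ([] , ↭-trans (prep x q) (↭-reflexive (sym (trans (++-identityʳ _)
          (cong (λ t → x ∷ y ∷ t) (concat-map-[ E ]))))))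
        (≤-trans (≤-reflexive (trans (cong (2 +_) (length-map [_] E)) 2+E≡p)) (n≤1+n p))
        (gaining-zeroSum (map [_] E) ((x≢y ∷ []) ∷ [] ∷ []) (here refl) (there (here refl)) x≢y
          (All-map⁺ (All.universal (λ _ → [] ∷ []) E))
          (≤-reflexive (trans n≡1+p (cong suc (trans (sym 2+E≡p)
            (cong (λ t → 2 + length t) (sym (concat-map-[ E ])))))))))
    unit-replicate : ∀ C → length C ≡ p → ZeroSum C (suc p) ⊎ (∃[ g ] (IsUnit g × C ≡ replicate p g))
    unit-replicate C len with constant? C len
    ... | inj₁ z = inj₁ z
    ... | inj₂ (g , C≡) with unit-or-torsion g
    ...   | inj₁ u = inj₂ (g , u , C≡)
    ...   | inj₂ (k , 1≤k , k<n , eq) = inj₁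
      (replicate k g , subst (replicate k g ≼_) (sym C≡) (replicate-mono-≼ g (≤-pred k<1+p)) ,
       ≤-trans 1≤k (≤-reflexive (sym (length-replicate k))) ,
       ≤-trans (≤-reflexive (length-replicate k)) (<⇒≤ k<1+p) , eq)
      where
      k<1+p : k < suc p
      k<1+p = subst (k <_) n≡1+p k<n

    zeros-and-units : ∀ h R → (∀ x → count x R ≤ h) → h + length R ≡ p + p →
      HasZeroSumₙ (replicate h 0ₙ ++ R) ⊎ (h ≡ p × ∃[ g ] (IsUnit g × R ↭ replicate p g))
    zeros-and-units h R bd len with h ≤? p
    ... | no h≰p = inj₁ (zeros-suffice h R (subst (_≤ h) (sym n≡1+p) (≰⇒> h≰p)))
    ... | yes h≤p with tight h R h≤p bd len
    ...   | inj₁ z = inj₁ z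
    ...   | inj₂ (W , C , q , eq , h+W≡p) = from-tight (m≤n⇒m<n∨m≡n h≤p)
      where
      bdC : ∀ x → count x C ≤ h
      bdC x = ≤-trans (count-mono x (W , ↭-trans q (++-comm W C))) (bd x)
      lenC : length C ≡ p
      lenC = +-cancelˡ-≡ p _ _ (trans (cong (_+ length C) (sym h+W≡p))
        (trans (+-assoc h _ _) (trans (cong (h +_) (sym (trans (↭-length q) (length-++ W)))) len)))
      R↭C : h ≡ p → ∀ V → R ↭ V ++ C → h + length V ≡ p → R ↭ C
      R↭C _ [] r _ = r
      R↭C h≡p (v ∷ V) _ eq = contradiction (trans eq (sym h≡p)) (m+1+n≢m h)
      from-tight : h < p ⊎ h ≡ p → _
      from-tight (inj₁ h<p) = inj₁ (combine W q eq h+W≡p (nonconstant-zeroSum h C h<p bdC lenC))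
      from-tight (inj₂ h≡p) with unit-replicate C lenC
      ... | inj₁ z = inj₁ (combine W q eq h+W≡p (subst (λ k → ZeroSum C (suc k)) (sym h≡p) z))
      ... | inj₂ (g , u , C≡) = inj₂ (h≡p , g , u , ↭-trans (R↭C h≡p W q h+W≡p) (↭-reflexive C≡))

    length-normal : ∀ {h z} {S R : List (Zn n)} → map (_+ₙ z) S ↭ replicate h 0ₙ ++ R → h + length R ≡ length S
    length-normal {h} {z} {S} {R} q = begin
      h + length R                         ≡⟨ cong (_+ length R) (length-replicate h) ⟨
      length (replicate h 0ₙ) + length R   ≡⟨ length-++ (replicate h 0ₙ) ⟨
      length (replicate h 0ₙ ++ R)         ≡⟨ ↭-length q ⟨
      length (map (_+ₙ z) S)               ≡⟨ length-map (_+ₙ z) S ⟩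
      length S                             ∎
      where open ≡-Reasoning

--CUT
    inverse-EGZ : ∀ S → length S ≡ p + p → HasZeroSumₙ S ⊎
      ∃₂ λ z g → IsUnit g × map (_+ₙ z) S ↭ replicate p 0ₙ ++ replicate p g
    inverse-EGZ S len = from-normal (normalise S)
      where
      from-normal : NormalForm S → _
      from-normal (h , z , R , bd , q) with zeros-and-units h R bd (trans (length-normal {h} {R = R} q) len)
      ... | inj₁ zs = inj₁ (HasZeroSumₙ-unshift z (HasZeroSumₙ-↭ (↭-sym q) zs))
      ... | inj₂ (h≡p , g , u , q′) = inj₂ (z , g , u ,
        ↭-trans q (++⁺ (↭-reflexive (cong (λ k → replicate k 0ₙ) h≡p)) q′))

    zeros-EGZ : ∀ h R → h ≤ p → (∀ x → count x R ≤ h) → h + length R ≡ suc (p + p) → HasZeroSumₙ (replicate h 0ₙ ++ R)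
    zeros-EGZ h R h≤p bd len = from-extract (extract h m R (<-wellFounded m) bd lenR)
      where
      m = p ∸ h
      h+m≡p : h + m ≡ p
      h+m≡p = m+[n∸m]≡n h≤p
      lenR : length R ≡ n + m
      lenR = +-cancelˡ-≡ h _ _ (begin
        h + length R     ≡⟨ len ⟩
        suc p + p        ≡⟨ cong₂ _+_ n≡1+p h+m≡p ⟨
        n + (h + m)      ≡⟨ x∙yz≈y∙xz n h m ⟩
        h + (n + m)      ∎)
        where
        open ≡-Reasoning
        open CommutativeSemigroupProperties +-commutativeSemigroup using (x∙yz≈y∙xz)
      p≤n : p ≤ n
      p≤n = ≤-trans (n≤1+n p) (≤-reflexive (sym n≡1+p))
      n≤ : n ≤ h + suc m
      n≤ = ≤-reflexive (trans n≡1+p (trans (cong suc (sym h+m≡p)) (sym (+-suc h m))))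
      from-extract : (∃₂ λ W C → R ↭ W ++ C × total W ≡ 0ₙ × suc m ≤ length W × length W ≤ m + h) → _
      from-extract (W , C , q , eq , ge , le) = pad h (C , q) eq
        (≤-trans le (≤-trans (≤-reflexive (trans (+-comm m h) h+m≡p)) p≤n))
        (≤-trans n≤ (+-monoʳ-≤ h ge))

    EGZ : ∀ S → length S ≡ suc (p + p) → HasZeroSumₙ S
    EGZ S len = from-normal (normalise S)
      where
      from-normal : NormalForm S → _
      from-normal (h , z , R , bd , q) = HasZeroSumₙ-unshift z (HasZeroSumₙ-↭ (↭-sym q) (cases (h ≤? p)))
        where
        cases : Dec (h ≤ p) → HasZeroSumₙ (replicate h 0ₙ ++ R)
        cases (no h≰p) = zeros-suffice h R (subst (_≤ h) (sym n≡1+p) (≰⇒> h≰p))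
        cases (yes h≤p) = zeros-EGZ h R h≤p bd (trans (length-normal {h} {R = R} q) len)

  open Equivalence using (to; from)

  private
    n≡1+[n-1] : n ≡ suc (n ∸ 1)
    n≡1+[n-1] = sym (suc-pred n)

  length-zerosOnes : length (zerosOnes {n}) ≡ (n ∸ 1) + (n ∸ 1)
  length-zerosOnes = trans (length-++ (replicate (n ∸ 1) 0ₙ)) (cong₂ _+_ (length-replicate (n ∸ 1)) (length-replicate (n ∸ 1)))

  sumℕ : List (Zn n) → ℕ
  sumℕ = sum ∘ map toℕ

  sumℕ-mod : ∀ T → sumℕ T mod n ≡ total T
  sumℕ-mod [] = refl
  sumℕ-mod (x ∷ T) = trans (sym (+-modʳ x (sumℕ T))) (cong (x +ₙ_) (sumℕ-mod T))

  sumℕ-++ : ∀ S T → sumℕ (S ++ T) ≡ sumℕ S + sumℕ T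
  sumℕ-++ S T = trans (cong sum (map-++ toℕ S T)) (sum-++ (map toℕ S) (map toℕ T))

  sumℕ-replicate : ∀ k x → sumℕ (replicate k x) ≡ k * toℕ x
  sumℕ-replicate zero x = refl
  sumℕ-replicate (suc k) x = cong (toℕ x +_) (sumℕ-replicate k x)

  sumℕ-mono : ∀ {S T} → S ⊆ T → sumℕ S ≤ sumℕ T
  sumℕ-mono [] = z≤n
  sumℕ-mono (y ∷ʳ p) = ≤-trans (sumℕ-mono p) (m≤n+m _ (toℕ y))
  sumℕ-mono (_∷_ {x} refl p) = +-monoʳ-≤ (toℕ x) (sumℕ-mono p)

  toℕ-0ₙ : toℕ (0ₙ {n}) ≡ 0
  toℕ-0ₙ = trans (toℕ-mod 0) (m*n%n≡0 0 n)

  toℕ-1ₙ : toℕ (1ₙ {n}) ≤ 1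
  toℕ-1ₙ = ≤-trans (≤-reflexive (toℕ-mod 1)) (m%n≤m 1 n)

  sumℕ≡0⇒zeros : ∀ T → sumℕ T ≡ 0 → All (0ₙ ≡_) T
  sumℕ≡0⇒zeros [] _ = []
  sumℕ≡0⇒zeros (x ∷ T) eq =
    toℕ-injective (trans toℕ-0ₙ (sym (m+n≡0⇒m≡0 (toℕ x) eq))) ∷ sumℕ≡0⇒zeros T (m+n≡0⇒n≡0 (toℕ x) eq)

  sumℕ-zerosOnes : sumℕ zerosOnes < n
  sumℕ-zerosOnes = begin-strict
    sumℕ zerosOnes                                                              ≡⟨ sumℕ-++ (replicate (n ∸ 1) 0ₙ) _ ⟩
    sumℕ (replicate (n ∸ 1) 0ₙ) + sumℕ (replicate (n ∸ 1) 1ₙ)                   ≡⟨ cong₂ _+_ (sumℕ-replicate (n ∸ 1) 0ₙ) (sumℕ-replicate (n ∸ 1) 1ₙ) ⟩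
    (n ∸ 1) * toℕ (0ₙ {n}) + (n ∸ 1) * toℕ (1ₙ {n})                             ≤⟨ +-mono-≤ (*-monoʳ-≤ (n ∸ 1) (≤-reflexive toℕ-0ₙ)) (*-monoʳ-≤ (n ∸ 1) toℕ-1ₙ) ⟩
    (n ∸ 1) * 0 + (n ∸ 1) * 1                                                   ≡⟨ cong₂ _+_ (*-zeroʳ (n ∸ 1)) (*-identityʳ (n ∸ 1)) ⟩
    n ∸ 1                                                                       <⟨ n<1+n (n ∸ 1) ⟩
    suc (n ∸ 1)                                                                 ≡⟨ n≡1+[n-1] ⟨
    n                                                                           ∎
    where open ≤-Reasoning

  0ₙ≢1ₙ : 2 ≤ n → 0ₙ {n} ≢ 1ₙ
  0ₙ≢1ₙ 2≤n eq = 0≢1+n (trans (sym toℕ-0ₙ) (trans (cong toℕ eq) (trans (toℕ-mod 1) (m<n⇒m%n≡m 2≤n))))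

  count-0-zerosOnes : 2 ≤ n → count 0ₙ zerosOnes < n
  count-0-zerosOnes 2≤n = begin-strict
    count 0ₙ zerosOnes                                                          ≡⟨ count-++ 0ₙ (replicate (n ∸ 1) 0ₙ) _ ⟩
    count 0ₙ (replicate (n ∸ 1) 0ₙ) + count 0ₙ (replicate (n ∸ 1) 1ₙ)           ≡⟨ cong (count 0ₙ (replicate (n ∸ 1) 0ₙ) +_) (cong length (filter-none (0ₙ ≟_) (replicate⁺ (n ∸ 1) (0ₙ≢1ₙ 2≤n)))) ⟩
    count 0ₙ (replicate (n ∸ 1) 0ₙ) + 0                                         ≡⟨ +-identityʳ _ ⟩
    count 0ₙ (replicate (n ∸ 1) 0ₙ)                                             ≤⟨ length-filter (0ₙ ≟_) (replicate (n ∸ 1) 0ₙ) ⟩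
    length (replicate (n ∸ 1) (0ₙ {n}))                                         ≡⟨ length-replicate (n ∸ 1) ⟩
    n ∸ 1                                                                       <⟨ n<1+n (n ∸ 1) ⟩
    suc (n ∸ 1)                                                                 ≡⟨ n≡1+[n-1] ⟨
    n                                                                           ∎
    where open ≤-Reasoning

  zerosOnes-zeroSumFree : 2 ≤ n → ¬ HasZeroSumₙ zerosOnes
  zerosOnes-zeroSumFree 2≤n (T , T⊆ , len , eq) = <⇒≱ (count-0-zerosOnes 2≤n) (begin
    n                        ≡⟨ len ⟨
    length T                 ≡⟨ cong length (filter-all (0ₙ ≟_) (sumℕ≡0⇒zeros T sum≡0)) ⟨
    count 0ₙ T               ≤⟨ count-mono 0ₙ (⊆⇒≼ T⊆) ⟩
    count 0ₙ zerosOnes       ∎)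
    where
    open ≤-Reasoning
    sum≡0 : sumℕ T ≡ 0
    sum≡0 = trans (sym (m<n⇒m%n≡m (≤-<-trans (sumℕ-mono T⊆) sumℕ-zerosOnes))) (mod≡0⇒%≡0 (trans (sumℕ-mod T) eq))

  sumₙ-lookup : ∀ T (a : Fin (length T) → Zn n) → (∀ i → a i ≡ 1ₙ) →
    sumₙ (length T) (λ i → a i *ₙ lookup T i) ≡ total T
  sumₙ-lookup [] a a≡1 = refl
  sumₙ-lookup (x ∷ T) a a≡1 = cong₂ _+ₙ_
    (trans (cong (_*ₙ x) (a≡1 fzero)) (trans (*ₙ-comm 1ₙ x) (*ₙ-identityʳ x)))
    (sumₙ-lookup T (a ∘ fsuc) (a≡1 ∘ fsuc))

  sumₙ-ones : ∀ k (a b : Fin k → Zn n) → (∀ i → a i ≡ 1ₙ) → (∀ i → b i ≡ 1ₙ) →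
    sumₙ k (λ i → b i *ₙ a i) ≡ k mod n
  sumₙ-ones zero a b a≡1 b≡1 = refl
  sumₙ-ones (suc k) a b a≡1 b≡1 = trans
    (cong₂ _+ₙ_ (trans (cong₂ _*ₙ_ (b≡1 fzero) (a≡1 fzero)) (*ₙ-identityʳ 1ₙ))
      (sumₙ-ones k (a ∘ fsuc) (b ∘ fsuc) (a≡1 ∘ fsuc) (b≡1 ∘ fsuc)))
    (mod-+ 1 k)

  AZeroSum⇔ : ∀ T → AZeroSum ｛1｝ T ⇔ total T ≡ 0ₙ
  AZeroSum⇔ T = mk⇔
    (λ (a , a≡1 , eq) → trans (sym (sumₙ-lookup T a a≡1)) eq)
    (λ eq → (λ _ → 1ₙ) , (λ _ → refl) , trans (sumₙ-lookup T (λ _ → 1ₙ) (λ _ → refl)) eq)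

  ABZeroSum⇔ : ∀ T → ABZeroSum ｛1｝ ｛1｝ T ⇔ (total T ≡ 0ₙ × length T mod n ≡ 0ₙ)
  ABZeroSum⇔ T = mk⇔
    (λ (a , b , a≡1 , b≡1 , eq , eq′) →
      trans (sym (sumₙ-lookup T a a≡1)) eq , trans (sym (sumₙ-ones (length T) a b a≡1 b≡1)) eq′)
    (λ (eq , eq′) → (λ _ → 1ₙ) , (λ _ → 1ₙ) , (λ _ → refl) , (λ _ → refl) ,
      trans (sumₙ-lookup T (λ _ → 1ₙ) (λ _ → refl)) eq ,
      trans (sumₙ-ones (length T) (λ _ → 1ₙ) (λ _ → 1ₙ) (λ _ → refl) (λ _ → refl)) eq′)

  n-mod : n mod n ≡ 0ₙ
  n-mod = trans (cong (_mod n) (sym (*-identityʳ n))) (n*k-mod 1)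

  length≡n⇒nonempty : ∀ {T : List (Zn n)} → length T ≡ n → T ≢ []
  length≡n⇒nonempty len refl = ≢-nonZero⁻¹ n (sym len)

  HasAZSn⇔ : ∀ S → HasAZSn ｛1｝ S ⇔ HasZeroSumₙ S
  HasAZSn⇔ S = mk⇔
    (λ (T , (T⊆S , _) , len , z) → T , T⊆S , len , to (AZeroSum⇔ T) z)
    (λ (T , T⊆S , len , eq) → T , (T⊆S , length≡n⇒nonempty len) , len , from (AZeroSum⇔ T) eq)

  HasABZSn⇔ : ∀ S → HasABZSn ｛1｝ ｛1｝ S ⇔ HasZeroSumₙ S
  HasABZSn⇔ S = mk⇔
    (λ (T , (T⊆S , _) , len , z) → T , T⊆S , len , proj₁ (to (ABZeroSum⇔ T) z))
    (λ (T , T⊆S , len , eq) → T , (T⊆S , length≡n⇒nonempty len) , len ,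
      from (ABZeroSum⇔ T) (eq , trans (cong (_mod n) len) n-mod))

  multiple<2n : ∀ {k} → k mod n ≡ 0ₙ → k ≢ 0 → k < n + n → k ≡ n
  multiple<2n {k} k≡0 k≢0 k<2n with m%n≡0⇒n∣m k n (mod≡0⇒%≡0 k≡0)
  ... | divides 0 eq = contradiction eq k≢0
  ... | divides 1 eq = trans eq (*-identityˡ n)
  ... | divides (suc (suc q)) eq = contradiction k<2n (≤⇒≯ (begin
      n + n              ≤⟨ m≤m+n (n + n) (q * n) ⟩
      n + n + q * n      ≡⟨ +-assoc n n _ ⟩
      n + (n + q * n)    ≡⟨ eq ⟨
      k                  ∎))
      where open ≤-Reasoning

  HasABZS⇔ : ∀ S → length S < n + n → HasABZS ｛1｝ ｛1｝ S ⇔ HasZeroSumₙ S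
  HasABZS⇔ S S<2n = mk⇔
    (λ (T , (T⊆S , T≢[]) , z) → let eq , len = to (ABZeroSum⇔ T) z in
      T , T⊆S , multiple<2n len (T≢[] ∘ length≡0⇒[]) (≤-<-trans (Sub.length-mono-≤ T⊆S) S<2n) , eq)
    (λ z → let T , T⊆S , _ , ab = from (HasABZSn⇔ S) z in T , T⊆S , ab)
    where
    length≡0⇒[] : ∀ {T : List (Zn n)} → length T ≡ 0 → T ≡ []
    length≡0⇒[] {[]} _ = refl

  -- The three zero-sum notions agree on sequences shorter than 2n, so they have the same extremal sequences.
  module _ (2≤n : 2 ≤ n) {Q : List (Zn n) → Set} (Q⇔ : ∀ S → length S < n + n → Q S ⇔ HasZeroSumₙ S) where

    2n-1<2n : suc ((n ∸ 1) + (n ∸ 1)) < n + n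
    2n-1<2n = ≤-reflexive (trans (cong suc (sym (+-suc (n ∸ 1) (n ∸ 1)))) (cong₂ _+_ (sym n≡1+[n-1]) (sym n≡1+[n-1])))

    2n-1-least : IsLeastPos (Every Q) (suc ((n ∸ 1) + (n ∸ 1)))
    2n-1-least = s≤s z≤n ,
      (λ S len → from (Q⇔ S (subst (_< n + n) (sym len) 2n-1<2n)) (EGZ n≡1+[n-1] S len)) ,
      λ m _ every → ≮⇒≥ λ m<2n-1 → let
        S = take m zerosOnes
        len = trans (length-take m zerosOnes) (m≤n⇒m⊓n≡m (≤-trans (≤-pred m<2n-1) (≤-reflexive (sym length-zerosOnes))))
        in zerosOnes-zeroSumFree 2≤n (HasZeroSumₙ-⊆ (Sub.take-⊆ m zerosOnes)
             (to (Q⇔ S (subst (_< n + n) (sym len) (<-trans m<2n-1 2n-1<2n))) (every S len)))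

    extremal⇔ : ∀ S → (∃[ k ] (IsLeastPos (Every Q) k × suc (length S) ≡ k × ¬ Q S)) ⇔
      (length S ≡ (n ∸ 1) + (n ∸ 1) × ¬ HasZeroSumₙ S)
    extremal⇔ S = mk⇔
      (λ (k , (0<k , every , least) , len , ¬Q) →
        let 0<m , every′ , least′ = 2n-1-least
            S≡ = suc-injective (trans len (≤-antisym (least _ 0<m every′) (least′ k 0<k every)))
        in S≡ , λ z → ¬Q (from (Q⇔ S (short S≡)) z))
      (λ (S≡ , ¬z) → _ , 2n-1-least , cong suc S≡ , λ q → ¬z (to (Q⇔ S (short S≡)) q))
      where
      short : length S ≡ (n ∸ 1) + (n ∸ 1) → length S < n + n
      short S≡ = <-trans (subst (_< suc ((n ∸ 1) + (n ∸ 1))) (sym S≡) (n<1+n _)) 2n-1<2n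

  zeroSumFree⇔ : 2 ≤ n → ∀ S →
    (length S ≡ (n ∸ 1) + (n ∸ 1) × ¬ HasZeroSumₙ S) ⇔ (∃[ T ] (IsTranslateOf S T × Equivalent T zerosOnes))
  zeroSumFree⇔ 2≤n S = mk⇔ ⇒ ⇐
    where
    p = n ∸ 1
    open ≡-Reasoning

    scale : ∀ g v → v *ₙ g ≡ 1ₙ → map (v *ₙ_) (replicate p 0ₙ ++ replicate p g) ≡ zerosOnes
    scale g v vg≡1 = begin
      map (v *ₙ_) (replicate p 0ₙ ++ replicate p g)                       ≡⟨ map-++ (v *ₙ_) (replicate p 0ₙ) _ ⟩
      map (v *ₙ_) (replicate p 0ₙ) ++ map (v *ₙ_) (replicate p g)         ≡⟨ cong₂ _++_ (map-replicate (v *ₙ_) p 0ₙ) (map-replicate (v *ₙ_) p g) ⟩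
      replicate p (v *ₙ 0ₙ) ++ replicate p (v *ₙ g)                       ≡⟨ cong₂ (λ a b → replicate p a ++ replicate p b) (*ₙ-zeroʳ v) vg≡1 ⟩
      zerosOnes                                                           ∎

    normal-form : (∃₂ λ z g → IsUnit g × map (_+ₙ z) S ↭ replicate p 0ₙ ++ replicate p g) →
      ∃[ T ] (IsTranslateOf S T × Equivalent T zerosOnes)
    normal-form (z , g , (v , gv≡1) , q) = map (_+ₙ z) S , (-ₙ z , sym (map-+ₙ-undo z S)) ,
      v , (g , vg≡1) , ↭-trans (↭-reflexive (sym (scale g v vg≡1))) (map⁺ (v *ₙ_) (↭-sym q))
      where
      vg≡1 : v *ₙ g ≡ 1ₙ
      vg≡1 = trans (*ₙ-comm v g) gv≡1

    ⇒ : length S ≡ p + p × ¬ HasZeroSumₙ S → ∃[ T ] (IsTranslateOf S T × Equivalent T zerosOnes)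
    ⇒ (len , ¬z) = [ (λ z → contradiction z ¬z) , normal-form ]′ (inverse-EGZ n≡1+[n-1] S len)

    ⇐ : (∃[ T ] (IsTranslateOf S T × Equivalent T zerosOnes)) → length S ≡ p + p × ¬ HasZeroSumₙ S
    ⇐ (T , (x , refl) , u , _ , q) =
      (begin
        length (map (_+ₙ x) T)     ≡⟨ length-map (_+ₙ x) T ⟩
        length T                   ≡⟨ length-map (u *ₙ_) T ⟨
        length (map (u *ₙ_) T)     ≡⟨ ↭-length q ⟨
        length zerosOnes           ≡⟨ length-zerosOnes ⟩
        p + p                      ∎) ,
      λ z → zerosOnes-zeroSumFree 2≤n
        (HasZeroSumₙ-↭ (↭-sym q) (HasZeroSumₙ-scale u (HasZeroSumₙ-unshift x z)))

theorem3 : (n : ℕ) .{{_ : NonZero n}} → 2 ≤ n → (S : List (Zn n)) →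
    (DExtremalAB ｛1｝ ｛1｝ S ⇔ EExtremalAB ｛1｝ ｛1｝ S) ×
    (EExtremalAB ｛1｝ ｛1｝ S ⇔ EExtremalA ｛1｝ S) ×
    (EExtremalA ｛1｝ S ⇔ (∃[ T ] (IsTranslateOf S T × Equivalent T zerosOnes)))
theorem3 n 2≤n S =
  (⇔-sym E ⇔-∘ D) , (⇔-sym E₁ ⇔-∘ E) , (zeroSumFree⇔ 2≤n S ⇔-∘ E₁)
  where
  D = extremal⇔ 2≤n {HasABZS ｛1｝ ｛1｝} HasABZS⇔ S
  E = extremal⇔ 2≤n {HasABZSn ｛1｝ ｛1｝} (λ T _ → HasABZSn⇔ T) S
  E₁ = extremal⇔ 2≤n {HasAZSn ｛1｝} (λ T _ → HasAZSn⇔ T) S
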